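{- Let $A$ be an $m\times m$ coloring matrix and $B=(b_{pq})$ an $m'\times m$ matrix with entries in $\{0,1\}$. Let $A'$ be the $(m+m')\times(m+m')$ block matrix $$A'=\left[\begin{array}{c|c}A&0\\\hline B&0\end{array}\right].$$ Then for every $1\le i\le m$, $F_{A'}^{(i)}(x)=F_A^{(i)}(x)$, and for every $m+1\le i\le m+m'$, $$F_{A'}^{(i)}(x)=\frac{x}{1-\sum_{j=1}^m b_{i-m,j}F_A^{(j)}(x)}.$$
   Context: A plane tree is an unlabeled rooted tree in which the children of every vertex are linearly ordered. A coloring matrix is a square matrix $A=(a_{ij})$ with entries in $\{0,1\}$. An $A$-coloring of a plane tree assigns to each vertex a color (an index of a row of $A$) such that whenever a vertex of color $j$ is a child of a vertex of color $i$, $a_{ij}=1$. Let $t_A^{(i)}(n)$ be the number of pairs (plane tree with $n$ vertices, $A$-coloring of it) in which the root has color $i$, and $F_A^{(i)}(x)=\sum_{n\ge1}t_A^{(i)}(n)x^n$ (formal power series). -}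

module Defs where

open import Data.Nat.Base as ℕ using (ℕ; zero; suc; _≤_; s≤s; _∸_)
import Data.Nat.Properties as ℕ
open import Data.Integer.Base as ℤ using (ℤ; +_; 0ℤ; 1ℤ)
import Data.Integer.Properties as ℤ
open import Data.Integer.Tactic.RingSolver using (solve-∀)
open import Algebra.Properties.CommutativeMonoid.Sum ℤ.+-0-commutativeMonoid using (sum; sum-cong-≗; sum-replicate-zero)
open import Data.Fin.Base using (Fin; zero; suc; toℕ)
open import Data.Fin.Properties using (0↔⊥; 1↔⊤; +↔⊎; *↔×)
open import Data.Vec.Functional using (_++_)
open import Data.List.Base using (List; []; _∷_)
open import Data.List.Relation.Unary.All using (All; []; _∷_)
open import Data.Product.Base using (Σ; ∃-syntax; _×_; _,_; proj₁; proj₂)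
open import Data.Product.Function.NonDependent.Propositional using (_×-↔_)
open import Data.Sum.Base using (_⊎_; inj₁; inj₂)
open import Data.Sum.Function.Propositional using (_⊎-↔_)
open import Data.Unit.Base using (⊤; tt)
open import Data.Empty using (⊥)
open import Function.Bundles using (_↔_; mk↔ₛ′)
open import Function.Properties.Inverse using (↔-sym; ↔-trans)
open import Relation.Binary.PropositionalEquality using (_≡_; refl; trans; cong; module ≡-Reasoning)

Matrix01 : ℕ → ℕ → Set
Matrix01 r c = Fin r → Fin c → Fin 2

ColoringMatrix : ℕ → Set
ColoringMatrix m = Matrix01 m m

zeroMatrix : ∀ {r c} → Matrix01 r c
zeroMatrix _ _ = zero

block : ∀ {r r′ c c′} → Matrix01 r c → Matrix01 r c′ →
        Matrix01 r′ c → Matrix01 r′ c′ → Matrix01 (r ℕ.+ r′) (c ℕ.+ c′)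
block P Q R S = (λ i → P i ++ Q i) ++ (λ i → R i ++ S i)

data PlaneTree : Set where
  node : List PlaneTree → PlaneTree

mutual
  size : PlaneTree → ℕ
  size (node ts) = suc (forestSize ts)

  forestSize : List PlaneTree → ℕ
  forestSize []       = 0
  forestSize (t ∷ ts) = size t ℕ.+ forestSize ts

-- An assignment of one of m colors to every vertex. It is first-order data
-- rather than a function on vertices so that _≡_ identifies two
-- assignments exactly when they agree at every vertex.
data Assignment (m : ℕ) : PlaneTree → Set where
  node : ∀ {ts} → Fin m → All (Assignment m) ts → Assignment m (node ts)

rootColor : ∀ {m t} → Assignment m t → Fin m
rootColor (node c _) = c

mutual
  IsColoring : ∀ {m t} → ColoringMatrix m → Assignment m t → Set
  IsColoring A (node c as) = ChildrenOK A c as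

  -- The children of a vertex of color c.
  ChildrenOK : ∀ {m ts} → ColoringMatrix m → Fin m → All (Assignment m) ts → Set
  ChildrenOK A c []       = ⊤
  ChildrenOK A c (a ∷ as) =
    (A c (rootColor a) ≡ suc zero × IsColoring A a) × ChildrenOK A c as

ColoredTree : ∀ {m} → ColoringMatrix m → Fin m → ℕ → Set
ColoredTree {m} A i n =
  Σ PlaneTree λ t → size t ≡ n ×
  Σ (Assignment m t) λ a → IsColoring A a × rootColor a ≡ i

Finite : Set → Set
Finite X = ∃[ k ] (X ↔ Fin k)

via : ∀ {X Y} → X ↔ Y → Finite Y → Finite X
via f (k , g) = k , ↔-trans f g

finite-⊥ : Finite ⊥
finite-⊥ = 0 , ↔-sym 0↔⊥

finite-⊤ : Finite ⊤
finite-⊤ = 1 , ↔-sym 1↔⊤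

finite-⊎ : ∀ {X Y} → Finite X → Finite Y → Finite (X ⊎ Y)
finite-⊎ (k , f) (l , g) = k ℕ.+ l , ↔-trans (f ⊎-↔ g) (↔-sym +↔⊎)

finite-× : ∀ {X Y} → Finite X → Finite Y → Finite (X × Y)
finite-× (k , f) (l , g) = k ℕ.* l , ↔-trans (f ×-↔ g) (↔-sym *↔×)

finite-entry : (x : Fin 2) → Finite (x ≡ suc zero)
finite-entry zero       = via (mk↔ₛ′ (λ ()) (λ ()) (λ ()) (λ ())) finite-⊥
finite-entry (suc zero) =
  via (mk↔ₛ′ (λ _ → tt) (λ _ → refl) (λ _ → refl) (λ { refl → refl })) finite-⊤

finite-ΣFin : ∀ n {P : Fin n → Set} → (∀ j → Finite (P j)) → Finite (Σ (Fin n) P)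
finite-ΣFin zero    fin = via (mk↔ₛ′ (λ ()) (λ ()) (λ ()) (λ ())) finite-⊥
finite-ΣFin (suc n) fin =
  via (mk↔ₛ′
        (λ { (zero , p) → inj₁ p ; (suc j , p) → inj₂ (j , p) })
        (λ { (inj₁ p) → zero , p ; (inj₂ (j , p)) → suc j , p })
        (λ { (inj₁ _) → refl ; (inj₂ _) → refl })
        (λ { (zero , _) → refl ; (suc _ , _) → refl }))
      (finite-⊎ (fin zero) (finite-ΣFin n (λ j → fin (suc j))))

Split : ℕ → (ℕ → ℕ → Set) → Set
Split n P = ∃[ k ] ∃[ l ] (k ℕ.+ l ≡ n × P k l)

finite-Split : ∀ n {P} → (∀ k l → k ℕ.+ l ≡ n → Finite (P k l)) → Finite (Split n P)
finite-Split zero fin =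
  via (mk↔ₛ′
        (λ { (zero , zero , refl , p) → p })
        (λ p → 0 , 0 , refl , p)
        (λ _ → refl)
        (λ { (zero , zero , refl , _) → refl }))
      (fin 0 0 refl)
finite-Split (suc n) {P} fin =
  via (mk↔ₛ′
        (λ { (zero , _ , refl , p) → inj₁ p
           ; (suc k , l , refl , p) → inj₂ (k , l , refl , p) })
        (λ { (inj₁ p) → 0 , suc n , refl , p
           ; (inj₂ (k , l , refl , p)) → suc k , l , refl , p })
        (λ { (inj₁ _) → refl ; (inj₂ (_ , _ , refl , _)) → refl })
        (λ { (zero , _ , refl , _) → refl ; (suc _ , _ , refl , _) → refl }))
      (finite-⊎ (fin 0 (suc n) refl)
                (finite-Split n {λ k l → P (suc k) l} (λ k l e → fin (suc k) l (cong suc e))))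

module _ {m} (A : ColoringMatrix m) where

  -- The possible families of subtrees, with n vertices in total, of a
  -- vertex of color i.
  ColoredForest : Fin m → ℕ → Set
  ColoredForest i n =
    Σ (List PlaneTree) λ ts → forestSize ts ≡ n × Σ (All (Assignment m) ts) (ChildrenOK A i)

  tree↔forest : ∀ i n → ColoredTree A i (suc n) ↔ ColoredForest i n
  tree↔forest i n = mk↔ₛ′
    (λ { (node ts , refl , node _ as , ok , refl) → ts , refl , as , ok })
    (λ { (ts , refl , as , ok) → node ts , refl , node i as , ok , refl })
    (λ { (_ , refl , _ , _) → refl })
    (λ { (node _ , refl , node _ _ , _ , refl) → refl })

  emptyForest↔⊤ : ∀ i → ColoredForest i 0 ↔ ⊤
  emptyForest↔⊤ i = mk↔ₛ′
    (λ _ → tt)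
    (λ _ → [] , refl , [] , tt)
    (λ _ → refl)
    (λ { ([] , refl , [] , _) → refl ; (node _ ∷ _ , () , _) })

  forest↔firstTree×forest : ∀ i n → ColoredForest i (suc n) ↔
    Split n (λ k l → Σ (Fin m) λ j → A i j ≡ suc zero × ColoredForest j k × ColoredForest i l)
  forest↔firstTree×forest i n = mk↔ₛ′
    (λ { (node us ∷ ts , refl , node j bs ∷ as , (e , okb) , oka) →
           forestSize us , forestSize ts , refl , j , e , (us , refl , bs , okb) , (ts , refl , as , oka) })
    (λ { (_ , _ , refl , j , e , (us , refl , bs , okb) , (ts , refl , as , oka)) →
           node us ∷ ts , refl , node j bs ∷ as , (e , okb) , oka })
    (λ { (_ , _ , refl , _ , _ , (_ , refl , _ , _) , (_ , refl , _ , _)) → refl })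
    (λ { (node _ ∷ _ , refl , node _ _ ∷ _ , (_ , _) , _) → refl })

  finite-forest : ∀ N n → n ≤ N → ∀ i → Finite (ColoredForest i n)
  finite-forest N       zero    _         i = via (emptyForest↔⊤ i) finite-⊤
  finite-forest (suc N) (suc n) (s≤s n≤N) i =
    via (forest↔firstTree×forest i n)
      (finite-Split n λ k l k+l≡n → finite-ΣFin m λ j →
        finite-× (finite-entry (A i j))
          (finite-×
            (finite-forest N k (ℕ.≤-trans (ℕ.m+n≤o⇒m≤o k (ℕ.≤-reflexive k+l≡n)) n≤N) j)
            (finite-forest N l (ℕ.≤-trans (ℕ.m+n≤o⇒n≤o k (ℕ.≤-reflexive k+l≡n)) n≤N) i)))

  finite-tree : ∀ i n → Finite (ColoredTree A i n)
  finite-tree i zero    =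
    via (mk↔ₛ′ (λ { (node _ , () , _) }) (λ ()) (λ ()) (λ { (node _ , () , _) })) finite-⊥
  finite-tree i (suc n) = via (tree↔forest i n) (finite-forest n n ℕ.≤-refl i)

  t : Fin m → ℕ → ℕ
  t i n = proj₁ (finite-tree i n)

  t-counts : ∀ i n → ColoredTree A i n ↔ Fin (t i n)
  t-counts i n = proj₂ (finite-tree i n)

-- Coefficient sequences of formal power series over ℤ.
Series : Set
Series = ℕ → ℤ

infix  4 _≈_
infixl 6 _-_
infixl 7 _*_ _·_ _÷_

_≈_ : Series → Series → Set
f ≈ g = ∀ n → f n ≡ g n

𝟙 : Series
𝟙 zero    = 1ℤ
𝟙 (suc _) = 0ℤ

X : Series
X zero          = 0ℤ
X (suc zero)    = 1ℤ
X (suc (suc _)) = 0ℤ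

_-_ : Series → Series → Series
(f - g) n = f n ℤ.- g n

_·_ : ℤ → Series → Series
(c · f) n = c ℤ.* f n

_*_ : Series → Series → Series
(f * g) n = sum {suc n} λ k → f (toℕ k) ℤ.* g (n ∸ toℕ k)

∑ : ∀ {m} → (Fin m → Series) → Series
∑ f n = sum λ j → f j n

tail : Series → Series
tail f n = f (suc n)

-- Long division: if g₀ = 1 then f = f₀ g + x r with r = tail (f - f₀ g),
-- so f / g = f₀ + x (r / g). It is the quotient only for g₀ = 1; see
-- ÷-*-cancel.
_÷_ : Series → Series → Series
(f ÷ g) zero    = f 0
(f ÷ g) (suc n) = (tail (f - f 0 · g) ÷ g) n

÷-*-cancel : ∀ f g → g 0 ≡ 1ℤ → (f ÷ g) * g ≈ f
÷-*-cancel f g g₀≡1 zero    = begin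
  f 0 ℤ.* g 0 ℤ.+ 0ℤ  ≡⟨ ℤ.+-identityʳ _ ⟩
  f 0 ℤ.* g 0         ≡⟨ cong (f 0 ℤ.*_) g₀≡1 ⟩
  f 0 ℤ.* 1ℤ          ≡⟨ ℤ.*-identityʳ _ ⟩
  f 0                 ∎
  where open ≡-Reasoning
÷-*-cancel f g g₀≡1 (suc n) =
  trans (cong (λ z → f 0 ℤ.* g (suc n) ℤ.+ z) (÷-*-cancel (tail (f - f 0 · g)) g g₀≡1 n))
        (lemma (f 0 ℤ.* g (suc n)) (f (suc n)))
  where
  lemma : ∀ a b → a ℤ.+ (b ℤ.- a) ≡ b
  lemma = solve-∀

entry : Fin 2 → ℤ
entry b = + toℕ b

F : ∀ {m} → ColoringMatrix m → Fin m → Series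
F A i zero    = 0ℤ
F A i (suc n) = + t A i (suc n)

-- ÷-*-cancel applies to every denominator of this shape.
denominator₀≡1 : ∀ {m} (A : ColoringMatrix m) (b : Fin m → Fin 2) →
                 (𝟙 - ∑ (λ j → entry (b j) · F A j)) 0 ≡ 1ℤ
denominator₀≡1 {m} A b = cong (λ z → 1ℤ ℤ.- z)
  (trans (sum-cong-≗ (λ j → ℤ.*-zeroʳ (entry (b j)))) (sum-replicate-zero m))

{-# OPTIONS --safe #-}

-- Cutting off the first child of the root shows that the series
-- C i = F i / x of forests below a vertex of color i satisfies
-- C i = 1 + x (∑ j aᵢⱼ C j) C i, which determines all coefficients. Since no
-- edge of A′ leads to a new color, the sum for A′ runs over the old colors
-- only: for an old color i the recurrence is that of A, and for a new color
-- it says C (1 - ∑ j bⱼ F j) = 1.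

module Submission where

open import Defs
open import Data.Nat.Base as ℕ using (ℕ; zero; suc; _∸_; _≤_; s≤s)
import Data.Nat.Properties as ℕ
open import Data.Integer.Base as ℤ using (ℤ; +_; 0ℤ; 1ℤ)
import Data.Integer.Properties as ℤ
open import Data.Integer.Tactic.RingSolver using (solve-∀)
open import Algebra.Properties.CommutativeMonoid.Sum ℤ.+-0-commutativeMonoid using (sum; sum-cong-≗; sum-replicate-zero; sum-permute)
open import Algebra.Properties.Semiring.Sum ℤ.+-*-semiring using (*-distribʳ-sum)
open import Data.Fin.Base using (Fin; zero; suc; toℕ; opposite; _↑ˡ_; _↑ʳ_)
open import Data.Fin.Properties using (opposite-prop; toℕ≤pred[n])
open import Data.Fin.Permutation using (↔⇒≡; reverse)
open import Data.Vec.Functional using (_++_)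
open import Data.Vec.Functional.Properties using (lookup-++ˡ; lookup-++ʳ)
open import Data.Product.Base using (_×_; _,_; proj₁; proj₂)
open import Function.Properties.Inverse using (↔-sym; ↔-trans)
open import Relation.Binary.PropositionalEquality using (_≡_; refl; sym; trans; cong; cong₂; module ≡-Reasoning)

open ≡-Reasoning

-- Coefficient `n` of a product sees only coefficients up to `n` of its factors. This bounded
-- congruence suits strong induction on the degree.
*-cong-≤ : ∀ {f f′ g g′ : Series} n → (∀ k → k ≤ n → f k ≡ f′ k) →
           (∀ k → k ≤ n → g k ≡ g′ k) → (f * g) n ≡ (f′ * g′) n
*-cong-≤ n f≡f′ g≡g′ = sum-cong-≗ λ k →
  cong₂ ℤ._*_ (f≡f′ (toℕ k) (toℕ≤pred[n] k)) (g≡g′ (n ∸ toℕ k) (ℕ.m∸n≤m n (toℕ k)))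

*-comm : ∀ f g → f * g ≈ g * f
*-comm f g n = trans
  (sum-permute (λ k → f (toℕ k) ℤ.* g (n ∸ toℕ k)) reverse)
  (sum-cong-≗ λ k → begin
    f (toℕ (opposite k)) ℤ.* g (n ∸ toℕ (opposite k))
      ≡⟨ cong (λ l → f l ℤ.* g (n ∸ l)) (opposite-prop k) ⟩
    f (n ∸ toℕ k) ℤ.* g (n ∸ (n ∸ toℕ k))
      ≡⟨ cong (λ l → f (n ∸ toℕ k) ℤ.* g l) (ℕ.m∸[m∸n]≡n (toℕ≤pred[n] k)) ⟩
    f (n ∸ toℕ k) ℤ.* g (toℕ k)
      ≡⟨ ℤ.*-comm (f (n ∸ toℕ k)) (g (toℕ k)) ⟩
    g (toℕ k) ℤ.* f (n ∸ toℕ k) ∎)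

-- By computation `(f * g) (suc n)` is `f 0 ℤ.* g (suc n) ℤ.+ (tail f * g) n`, so the induction on
-- `n` passes from `f` to `tail f`.
*-identityʳ : ∀ f → f * 𝟙 ≈ f
*-identityʳ f zero    = trans (ℤ.+-identityʳ _) (ℤ.*-identityʳ (f 0))
*-identityʳ f (suc n) =
  trans (cong₂ ℤ._+_ (ℤ.*-zeroʳ (f 0)) (*-identityʳ (tail f) n)) (ℤ.+-identityˡ _)

*-distribˡ-- : ∀ f g h → f * (g - h) ≈ f * g - f * h
*-distribˡ-- f g h zero    = lemma (f 0) (g 0) (h 0)
  where
  lemma : ∀ a b c → a ℤ.* (b ℤ.- c) ℤ.+ 0ℤ ≡ (a ℤ.* b ℤ.+ 0ℤ) ℤ.- (a ℤ.* c ℤ.+ 0ℤ)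
  lemma = solve-∀
*-distribˡ-- f g h (suc n) =
  trans (cong (λ z → f 0 ℤ.* (g (suc n) ℤ.- h (suc n)) ℤ.+ z) (*-distribˡ-- (tail f) g h n))
        (lemma (f 0) (g (suc n)) (h (suc n)) ((tail f * g) n) ((tail f * h) n))
  where
  lemma : ∀ a b c u v →
          a ℤ.* (b ℤ.- c) ℤ.+ (u ℤ.- v) ≡ (a ℤ.* b ℤ.+ u) ℤ.- (a ℤ.* c ℤ.+ v)
  lemma = solve-∀

-- Follows the long division: the constant term forces `h 0 ≡ f 0`, and removing the summand with
-- `h 0` leaves `tail h * g ≈ tail (f - f 0 · g)`, the same problem one degree lower.
÷-unique : ∀ f g h → g 0 ≡ 1ℤ → h * g ≈ f → h ≈ f ÷ g
÷-unique f g h g₀≡1 hg≈f = go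
  where
  h₀≡f₀ : h 0 ≡ f 0
  h₀≡f₀ = begin
    h 0                 ≡⟨ ℤ.*-identityʳ (h 0) ⟨
    h 0 ℤ.* 1ℤ          ≡⟨ cong (h 0 ℤ.*_) g₀≡1 ⟨
    h 0 ℤ.* g 0         ≡⟨ ℤ.+-identityʳ _ ⟨
    h 0 ℤ.* g 0 ℤ.+ 0ℤ  ≡⟨ hg≈f 0 ⟩
    f 0                 ∎

  cancel : ∀ a b → b ≡ (a ℤ.+ b) ℤ.- a
  cancel = solve-∀

  go : h ≈ f ÷ g
  go zero    = h₀≡f₀
  go (suc n) = ÷-unique (tail (f - f 0 · g)) g (tail h) g₀≡1
    (λ k → trans (cancel (h 0 ℤ.* g (suc k)) ((tail h * g) k))
                 (cong₂ ℤ._-_ (hg≈f (suc k)) (cong (ℤ._* g (suc k)) h₀≡f₀))) n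

-- Makes a count independent of how the enumeration was built, in particular of the recursion bound
-- `N` in `finite-forest`.
finite-unique : ∀ {X} (p q : Finite X) → proj₁ p ≡ proj₁ q
finite-unique (_ , f) (_ , g) = ↔⇒≡ (↔-trans (↔-sym f) g)

finite-entry-count : ∀ x → + proj₁ (finite-entry x) ≡ entry x
finite-entry-count zero       = refl
finite-entry-count (suc zero) = refl

finite-ΣFin-count : ∀ n {P : Fin n → Set} (fin : ∀ j → Finite (P j)) →
                    + proj₁ (finite-ΣFin n fin) ≡ sum (λ j → + proj₁ (fin j))
finite-ΣFin-count zero    fin = refl
finite-ΣFin-count (suc n) fin =
  cong (λ z → + proj₁ (fin zero) ℤ.+ z) (finite-ΣFin-count n (λ j → fin (suc j)))

-- A pair with `k ℕ.+ l ≡ n` is determined by `k`, so splits are counted by a sum of the shape of a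
-- convolution.
finite-Split-count : ∀ n {P : ℕ → ℕ → Set} (fin : ∀ k l → k ℕ.+ l ≡ n → Finite (P k l))
                     (c : ℕ → ℕ → ℤ) → (∀ k l e → + proj₁ (fin k l e) ≡ c k l) →
                     + proj₁ (finite-Split n {P} fin) ≡ sum {suc n} (λ k → c (toℕ k) (n ∸ toℕ k))
finite-Split-count zero    fin c eq = trans (eq 0 0 refl) (sym (ℤ.+-identityʳ _))
finite-Split-count (suc n) fin c eq = cong₂ ℤ._+_ (eq 0 (suc n) refl)
  (finite-Split-count n _ (λ k l → c (suc k) l) (λ k l e → eq (suc k) l (cong suc e)))

module _ {m} (A : ColoringMatrix m) where

  finite-forest-count : ∀ N n (n≤N : n ≤ N) i →
                        + proj₁ (finite-forest A N n n≤N i) ≡ tail (F A i) n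
  finite-forest-count N n n≤N i =
    cong +_ (finite-unique (finite-forest A N n n≤N i) (finite-forest A n n ℕ.≤-refl i))

  -- The enumeration of nonempty forests is built along `forest↔firstTree×forest`, so its count is
  -- read off layer by layer. The root of the first tree uses up one vertex, hence coefficient `n`
  -- on the right.
  tailF-suc : ∀ i n → tail (F A i) (suc n) ≡
              (∑ (λ j → entry (A i j) · tail (F A j)) * tail (F A i)) n
  tailF-suc i n = trans
    (finite-Split-count n _ c λ k l e → trans (finite-ΣFin-count m _) (sum-cong-≗ λ j →
      trans (ℤ.pos-* (proj₁ (finite-entry (A i j))) _)
        (cong₂ ℤ._*_ (finite-entry-count (A i j))
          (trans (ℤ.pos-* (proj₁ (finite-forest A n k _ j)) _)
            (cong₂ ℤ._*_ (finite-forest-count n k _ j) (finite-forest-count n l _ i))))))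
    (sum-cong-≗ {suc n} λ k → factor (toℕ k) (n ∸ toℕ k))
    where
    c : ℕ → ℕ → ℤ
    c k l = sum λ j → entry (A i j) ℤ.* (tail (F A j) k ℤ.* tail (F A i) l)

    -- The forest of later siblings does not depend on the color `j` of the first child.
    factor : ∀ k l → c k l ≡ ∑ (λ j → entry (A i j) · tail (F A j)) k ℤ.* tail (F A i) l
    factor k l = trans
      (sum-cong-≗ λ j → sym (ℤ.*-assoc (entry (A i j)) (tail (F A j) k) (tail (F A i) l)))
      (sym (*-distribʳ-sum (tail (F A i) l) (λ j → entry (A i j) ℤ.* tail (F A j) k)))

∑-entry-++-zero : ∀ {m m′} (b : Fin m → Fin 2) (f : Fin (m ℕ.+ m′) → Series) →
                  ∑ (λ j → entry ((b ++ λ _ → zero) j) · f j) ≈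
                  ∑ (λ j → entry (b j) · f (j ↑ˡ m′))
∑-entry-++-zero {m} {m′} b f n = trans (sum-↑ m _) (trans
  (cong₂ ℤ._+_
    (sum-cong-≗ λ j → cong (λ x → entry x ℤ.* f (j ↑ˡ m′) n) (lookup-++ˡ b (λ _ → zero) j))
    (trans
      (sum-cong-≗ λ j → cong (λ x → entry x ℤ.* f (m ↑ʳ j) n) (lookup-++ʳ b (λ _ → zero) j))
      (sum-replicate-zero m′)))
  (ℤ.+-identityʳ _))
  where
  sum-↑ : ∀ m (g : Fin (m ℕ.+ m′) → ℤ) →
          sum g ≡ sum (λ j → g (j ↑ˡ m′)) ℤ.+ sum (λ j → g (m ↑ʳ j))
  sum-↑ zero    g = sym (ℤ.+-identityˡ _)
  sum-↑ (suc m) g = trans (cong (λ z → g zero ℤ.+ z) (sum-↑ m (λ j → g (suc j))))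
                          (sym (ℤ.+-assoc (g zero) _ _))

module _ {m m′} (A : ColoringMatrix m) (B : Matrix01 m′ m) where

  private
    A′ : ColoringMatrix (m ℕ.+ m′)
    A′ = block A zeroMatrix B zeroMatrix

  -- Treats old and new colors at once: every row of `A′` is some `b`, a row of `A` or of `B`,
  -- padded with zeros.
  tailF-block-suc : ∀ i (b : Fin m → Fin 2) → A′ i ≡ b ++ (λ _ → zero) → ∀ n →
                    tail (F A′ i) (suc n) ≡
                    (∑ (λ j → entry (b j) · tail (F A′ (j ↑ˡ m′))) * tail (F A′ i)) n
  tailF-block-suc i b row n = trans (tailF-suc A′ i n)
    (*-cong-≤ {g = tail (F A′ i)} n
      (λ k _ → trans
        (cong (λ r → ∑ (λ j → entry (r j) · tail (F A′ j)) k) row)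
        (∑-entry-++-zero b (λ j → tail (F A′ j)) k))
      (λ _ _ → refl))

  tailF-old≤ : ∀ N n → n ≤ N → ∀ i → tail (F A′ (i ↑ˡ m′)) n ≡ tail (F A i) n
  -- Both sides count the empty forest alone.
  tailF-old≤ N       zero    _         i = refl
  tailF-old≤ (suc N) (suc n) (s≤s n≤N) i = begin
    tail (F A′ (i ↑ˡ m′)) (suc n)
      ≡⟨ tailF-block-suc (i ↑ˡ m′) (A i)
           (lookup-++ˡ (λ q → A q ++ zeroMatrix q) (λ q → B q ++ zeroMatrix q) i) n ⟩
    (∑ (λ j → entry (A i j) · tail (F A′ (j ↑ˡ m′))) * tail (F A′ (i ↑ˡ m′))) n
      ≡⟨ *-cong-≤ n
           (λ k k≤n → sum-cong-≗ λ j → cong (entry (A i j) ℤ.*_) (ih k k≤n j))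
           (λ k k≤n → ih k k≤n i) ⟩
    (∑ (λ j → entry (A i j) · tail (F A j)) * tail (F A i)) n
      ≡⟨ tailF-suc A i n ⟨
    tail (F A i) (suc n) ∎
    where
    ih : ∀ k → k ≤ n → ∀ j → tail (F A′ (j ↑ˡ m′)) k ≡ tail (F A j) k
    ih k k≤n = tailF-old≤ N k (ℕ.≤-trans k≤n n≤N)

  F-old : ∀ i → F A′ (i ↑ˡ m′) ≈ F A i
  F-old i zero    = refl
  F-old i (suc n) = tailF-old≤ n n ℕ.≤-refl i

  module _ (p : Fin m′) where

    private
      C D : Series
      C = tail (F A′ (m ↑ʳ p))
      D = ∑ (λ j → entry (B p j) · F A j)

      D₀≡0 : D 0 ≡ 0ℤ
      D₀≡0 = trans (sum-cong-≗ (λ j → ℤ.*-zeroʳ (entry (B p j)))) (sum-replicate-zero m)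

    -- Children of a new vertex have old colors, so `F-old` turns their series into those of `A`;
    -- the later siblings still hang below the new vertex and keep the factor `C`.
    tailF-new-suc : ∀ n → C (suc n) ≡ (tail D * C) n
    tailF-new-suc n = trans
      (tailF-block-suc (m ↑ʳ p) (B p)
        (lookup-++ʳ (λ q → A q ++ zeroMatrix q) (λ q → B q ++ zeroMatrix q) p) n)
      (*-cong-≤ {g = C} n
        (λ k _ → sum-cong-≗ λ j → cong (entry (B p j) ℤ.*_) (F-old j (suc k)))
        (λ _ _ → refl))

    tailF-new-* : C * (𝟙 - D) ≈ 𝟙
    tailF-new-* n = begin
      (C * (𝟙 - D)) n             ≡⟨ *-distribˡ-- C 𝟙 D n ⟩
      -- With `D` on the left, the product unfolds at `D 0`, which vanishes, and leaves `tail D * C`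
      -- as in `tailF-new-suc`.
      (C * 𝟙) n ℤ.- (C * D) n     ≡⟨ cong₂ ℤ._-_ (*-identityʳ C n) (*-comm C D n) ⟩
      C n ℤ.- (D * C) n           ≡⟨ C-DC n ⟩
      𝟙 n                         ∎
      where
      C-DC : C - D * C ≈ 𝟙
      C-DC zero    = cong (λ d → 1ℤ ℤ.- (d ℤ.* 1ℤ ℤ.+ 0ℤ)) D₀≡0
      C-DC (suc k) = begin
        C (suc k) ℤ.- (D 0 ℤ.* C (suc k) ℤ.+ (tail D * C) k)
          ≡⟨ cong₂ (λ d z → C (suc k) ℤ.- (d ℤ.* C (suc k) ℤ.+ z)) D₀≡0 (sym (tailF-new-suc k)) ⟩
        C (suc k) ℤ.- (0ℤ ℤ.* C (suc k) ℤ.+ C (suc k))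
          ≡⟨ cancel (C (suc k)) ⟩
        0ℤ ∎
        where
        cancel : ∀ c → c ℤ.- (0ℤ ℤ.* c ℤ.+ c) ≡ 0ℤ
        cancel = solve-∀

    F-new : F A′ (m ↑ʳ p) ≈ X ÷ (𝟙 - D)
    F-new = ÷-unique X (𝟙 - D) (F A′ (m ↑ʳ p)) (denominator₀≡1 A (B p)) λ
      -- The series has constant term `0ℤ` and tail `C`, so its product with `𝟙 - D` is
      -- `tailF-new-*` shifted by one degree; the case split lets `X` compute to the shifted `𝟙`.
      { zero          → refl
      ; (suc zero)    → trans (ℤ.+-identityˡ _) (tailF-new-* 0)
      ; (suc (suc n)) → trans (ℤ.+-identityˡ _) (tailF-new-* (suc n))
      }

theorem24 : (m m′ : ℕ) (A : ColoringMatrix m) (B : Matrix01 m′ m) →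
    let A′ = block A zeroMatrix B zeroMatrix in
    ((i : Fin m) → F A′ (i ↑ˡ m′) ≈ F A i) ×
    ((p : Fin m′) → F A′ (m ↑ʳ p) ≈ X ÷ (𝟙 - ∑ (λ j → entry (B p j) · F A j)))
theorem24 m m′ A B = F-old A B , F-new A B
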